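{- $\mathbf{GR}^-$ enjoys uniform interpolation property: for every $\mathcal{L}_2$-formula $A$ and every finite set $P$ of propositional variables there is an $\mathcal{L}_2$-formula $C$ such that (1) $v(C)\subseteq v(A)\setminus P$; (2) $\mathbf{GR}^-\vdash A\to C$; (3) for every $\mathcal{L}_2$-formula $B$, if $\mathbf{GR}^-\vdash A\to B$ and $v(B)\cap P=\emptyset$, then $\mathbf{GR}^-\vdash C\to B$.
   Context: $\mathcal{L}_2$ is the bimodal propositional language with countably many propositional variables, $\bot$, connectives $\neg,\vee$ (others defined), and unary modal operators $\Box,\blacksquare$; $\Diamond$ abbreviates $\neg\Box\neg$; $v(A)$ denotes the set of propositional variables occurring in $A$. The logic $\mathbf{GR}^-$ has as axioms all propositional tautologies of $\mathcal{L}_2$ and all instances of $\Box(A\to B)\to(\Box A\to\Box B)$, $\Box(\Box A\to A)\to\Box A$, $\blacksquare A\to\Box A$, $\Box A\to\Box\blacksquare A$, $\Box A\to(\Box\bot\vee\blacksquare A)$, $\Diamond\blacksquare A\to\Diamond A$, and rules modus ponens and $\Box$-necessitation (from $A$ infer $\Box A$). -}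

module Defs where

open import Data.Nat using (ℕ)
open import Data.Bool using (Bool; true; false; not; _∨_)
open import Data.List using (List; []; _∷_; _++_)
open import Relation.Binary.PropositionalEquality using (_≡_)

data Form : Set where
  var : ℕ → Form
  ⊥'  : Form
  ¬'_ : Form → Form
  _∨'_ : Form → Form → Form
  □_  : Form → Form
  ■_  : Form → Form

infixr 6 _∨'_
infixr 5 _⇒_
infix 8 ¬'_ □_ ■_ ◇_

_⇒_ : Form → Form → Form
A ⇒ B = (¬' A) ∨' B

⊤' : Form
⊤' = ¬' ⊥'

_∧'_ : Form → Form → Form
A ∧' B = ¬' ((¬' A) ∨' (¬' B))

◇_ : Form → Form
◇ A = ¬' (□ (¬' A))

-- Classical truth value of a formula, treating propositional variables and
-- modalized formulas (□A, ■A) as propositional atoms valued by ρ.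
eval : (Form → Bool) → Form → Bool
eval ρ (var p) = ρ (var p)
eval ρ ⊥' = false
eval ρ (¬' A) = not (eval ρ A)
eval ρ (A ∨' B) = eval ρ A ∨ eval ρ B
eval ρ (□ A) = ρ (□ A)
eval ρ (■ A) = ρ (■ A)

Tautology : Form → Set
Tautology A = (ρ : Form → Bool) → eval ρ A ≡ true

data GR⁻⊢_ : Form → Set where
  taut   : ∀ {A} → Tautology A → GR⁻⊢ A
  axK    : ∀ A B → GR⁻⊢ (□ (A ⇒ B) ⇒ (□ A ⇒ □ B))
  axL    : ∀ A → GR⁻⊢ (□ (□ A ⇒ A) ⇒ □ A)
  ax■□   : ∀ A → GR⁻⊢ (■ A ⇒ □ A)
  ax□□■  : ∀ A → GR⁻⊢ (□ A ⇒ □ (■ A))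
  ax□⊥■  : ∀ A → GR⁻⊢ (□ A ⇒ (□ ⊥' ∨' ■ A))
  ax◇■   : ∀ A → GR⁻⊢ (◇ (■ A) ⇒ ◇ A)
  mp     : ∀ {A B} → GR⁻⊢ (A ⇒ B) → GR⁻⊢ A → GR⁻⊢ B
  nec    : ∀ {A} → GR⁻⊢ A → GR⁻⊢ (□ A)

infix 2 GR⁻⊢_

vars : Form → List ℕ
vars (var p) = p ∷ []
vars ⊥' = []
vars (¬' A) = vars A
vars (A ∨' B) = vars A ++ vars B
vars (□ A) = vars A
vars (■ A) = vars A

{-# OPTIONS --safe #-}
module Submission where

-- A type is a truth assignment t to the atoms of the closure of A, and θ t says that the current
-- world becomes a world of type t after the variables in P (and the values ■ D at dead ends, for
-- D containing such variables) are reinterpreted in a suitable bisimilar model. Besides the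
-- literals not involving P, θ t asserts □ ⋁ θ x over the successor types x of t, and for each □ B
-- false in t a ◇ of witnesses x. A witness makes one more box true, so only the successors with the
-- same boxes as t are circular, and for them the fixed point is explicit (see step).
-- The interpolant is the disjunction of θ t over the types t that make A true.
-- It is least because the product of an arbitrary model with the set of types can be carried out
-- inside the logic: tr B t expresses the truth of B at the pair (current world, t). Derivability of B
-- gives θ t ⇒ tr B t, while under θ t the formula tr B t is decided by t for B in the closure,
-- and equivalent to B when B has no variables in P. Hence no completeness theorem is needed.

open import Defs
open import Data.Bool using (Bool; true; false; not; _∨_; if_then_else_)
open import Data.Bool.Properties using (¬-not) renaming (_≟_ to _≟ᵇ_)
open import Data.Empty using (⊥; ⊥-elim)
open import Data.Unit using (⊤; tt)
open import Data.Nat using (ℕ; zero; suc; _+_; _≤_; _<_; z≤n; s≤s)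
open import Data.Nat.Properties using (≤-refl; <-≤-trans; +-mono-≤; +-mono-≤-<) renaming (_≟_ to _≟ⁿ_)
open import Data.List using (List; []; _∷_; _++_; map; filter; length)
open import Data.List.Membership.Propositional using (_∈_; _∉_; find)
open import Data.List.Membership.Propositional.Properties using (∈-++⁺ˡ; ∈-++⁺ʳ; ∈-++⁻; ∈-map⁺; ∈-map⁻; ∈-filter⁺; ∈-filter⁻)
import Data.List.Membership.DecPropositional as DecMembership
open import Data.List.Relation.Unary.All as All using (All; []; _∷_)
open import Data.List.Relation.Unary.All.Properties using (++⁺; ++⁻; ¬All⇒Any¬)
open import Data.List.Relation.Unary.Any using (here; there)
open import Data.Product using (Σ; ∃; _×_; _,_; proj₁; proj₂)
open import Data.Sum using (_⊎_; inj₁; inj₂; [_,_]′)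
open import Function using (_∘_; id)
open import Relation.Binary.Definitions using (DecidableEquality)
open import Relation.Binary.PropositionalEquality using (_≡_; refl; sym; trans; cong; cong₂; subst)
open import Relation.Nullary using (¬_; Dec; yes; no; does; contradiction)
open import Relation.Nullary.Decidable using (map′; _×-dec_; _→-dec_; ¬?)

-- Propositional reasoning

-- A record rather than the bare equation, so that `ρ` and `A` are recovered by unification: `eval`
-- is not injective.
record _⊨_ (ρ : Form → Bool) (A : Form) : Set where
  constructor ⟨_⟩
  field holds : eval ρ A ≡ true

open _⊨_

infix 3 _⊨_

private variable
  ρ : Form → Bool
  A B C D : Form
  X : Set

_⊨?_ : ∀ ρ A → Dec (ρ ⊨ A)
ρ ⊨? A = map′ ⟨_⟩ holds (eval ρ A ≟ᵇ true)

¬-intro : (ρ ⊨ A → ⊥) → ρ ⊨ ¬' A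
¬-intro {ρ} {A} f with eval ρ A in e
... | true  = ⊥-elim (f ⟨ e ⟩)
... | false = ⟨ cong not e ⟩

¬-elim : ρ ⊨ ¬' A → ρ ⊨ A → ⊥
¬-elim ⟨ n ⟩ ⟨ a ⟩ = contradiction (trans (sym n) (cong not a)) λ ()

∨-introˡ : ρ ⊨ A → ρ ⊨ A ∨' B
∨-introˡ ⟨ a ⟩ = ⟨ cong (_∨ _) a ⟩

∨-introʳ : ρ ⊨ B → ρ ⊨ A ∨' B
∨-introʳ {ρ} {B} {A} ⟨ b ⟩ with eval ρ A in e
... | true  = ∨-introˡ ⟨ e ⟩
... | false = ⟨ trans (cong (_∨ _) e) b ⟩

∨-elim : ρ ⊨ A ∨' B → (ρ ⊨ A) ⊎ (ρ ⊨ B)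
∨-elim {ρ} {A} ⟨ d ⟩ with eval ρ A in e
... | true  = inj₁ ⟨ e ⟩
... | false = inj₂ ⟨ d ⟩

⇒-intro : (ρ ⊨ A → ρ ⊨ B) → ρ ⊨ A ⇒ B
⇒-intro {ρ} {A} f with ρ ⊨? A
... | yes a = ∨-introʳ (f a)
... | no ¬a = ∨-introˡ (¬-intro ¬a)

⇒-elim : ρ ⊨ A ⇒ B → ρ ⊨ A → ρ ⊨ B
⇒-elim i a = [ (λ n → ⊥-elim (¬-elim n a)) , id ]′ (∨-elim i)

∧-intro : ρ ⊨ A → ρ ⊨ B → ρ ⊨ A ∧' B
∧-intro a b = ¬-intro λ d → [ (λ n → ¬-elim n a) , (λ n → ¬-elim n b) ]′ (∨-elim d)

¬¬-elim : ((ρ ⊨ A → ⊥) → ⊥) → ρ ⊨ A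
¬¬-elim {ρ} {A} f with ρ ⊨? A
... | yes a = a
... | no ¬a = ⊥-elim (f ¬a)

∧-elimˡ : ρ ⊨ A ∧' B → ρ ⊨ A
∧-elimˡ c = ¬¬-elim λ ¬a → ¬-elim c (∨-introˡ (¬-intro ¬a))

∧-elimʳ : ρ ⊨ A ∧' B → ρ ⊨ B
∧-elimʳ c = ¬¬-elim λ ¬b → ¬-elim c (∨-introʳ (¬-intro ¬b))

⋁ : (X → Form) → List X → Form
⋁ f []       = ⊥'
⋁ f (x ∷ xs) = f x ∨' ⋁ f xs

⋀ : (X → Form) → List X → Form
⋀ f []       = ⊤'
⋀ f (x ∷ xs) = f x ∧' ⋀ f xs

⋁-intro : ∀ {f : X → Form} {x xs} → x ∈ xs → ρ ⊨ f x → ρ ⊨ ⋁ f xs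
⋁-intro (here refl) a = ∨-introˡ a
⋁-intro (there x∈)  a = ∨-introʳ (⋁-intro x∈ a)

⋁-elim : ∀ {f : X → Form} xs → ρ ⊨ ⋁ f xs → ∃ λ x → x ∈ xs × ρ ⊨ f x
⋁-elim []       ⟨ () ⟩
⋁-elim (x ∷ xs) d with ∨-elim d
... | inj₁ a = x , here refl , a
... | inj₂ e with ⋁-elim xs e
...   | y , y∈ , b = y , there y∈ , b

⋀-intro : ∀ {f : X → Form} xs → (∀ {x} → x ∈ xs → ρ ⊨ f x) → ρ ⊨ ⋀ f xs
⋀-intro []       g = ⟨ refl ⟩
⋀-intro (x ∷ xs) g = ∧-intro (g (here refl)) (⋀-intro xs (g ∘ there))

⋀-elim : ∀ {f : X → Form} {x xs} → ρ ⊨ ⋀ f xs → x ∈ xs → ρ ⊨ f x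
⋀-elim c (here refl) = ∧-elimˡ c
⋀-elim c (there x∈)  = ⋀-elim (∧-elimʳ c) x∈

⋁-cong : ∀ {f g : X → Form} xs → (∀ {x} → x ∈ xs → f x ≡ g x) → ⋁ f xs ≡ ⋁ g xs
⋁-cong []       e = refl
⋁-cong (x ∷ xs) e = cong₂ _∨'_ (e (here refl)) (⋁-cong xs (e ∘ there))

⋀-cong : ∀ {f g : X → Form} xs → (∀ {x} → x ∈ xs → f x ≡ g x) → ⋀ f xs ≡ ⋀ g xs
⋀-cong []       e = refl
⋀-cong (x ∷ xs) e = cong₂ _∧'_ (e (here refl)) (⋀-cong xs (e ∘ there))

infix 4 _⇔_

_⇔_ : Form → Form → Form
A ⇔ B = (A ⇒ B) ∧' (B ⇒ A)

⇔-intro : (ρ ⊨ A → ρ ⊨ B) → (ρ ⊨ B → ρ ⊨ A) → ρ ⊨ (A ⇔ B)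
⇔-intro f g = ∧-intro (⇒-intro f) (⇒-intro g)

⇔-elimˡ : ρ ⊨ (A ⇔ B) → ρ ⊨ A → ρ ⊨ B
⇔-elimˡ = ⇒-elim ∘ ∧-elimˡ

⇔-elimʳ : ρ ⊨ (A ⇔ B) → ρ ⊨ B → ρ ⊨ A
⇔-elimʳ = ⇒-elim ∘ ∧-elimʳ

signed : Bool → Form → Form
signed true  A = A
signed false A = ¬' A

signed-eval : ∀ A → ρ ⊨ signed (eval ρ A) A
signed-eval {ρ} A with eval ρ A in e
... | true  = ⟨ e ⟩
... | false = ⟨ cong not e ⟩

eval-signed : ∀ b → ρ ⊨ signed b A → eval ρ A ≡ b
eval-signed true  ⟨ a ⟩ = a
eval-signed {ρ} {A} false ⟨ a ⟩ with eval ρ A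
... | false = refl

signed-¬ : ∀ b → ρ ⊨ signed b A → ρ ⊨ signed (not b) (¬' A)
signed-¬ true  a = ¬-intro λ n → ¬-elim n a
signed-¬ false a = a

signed-∨ : ∀ b c → ρ ⊨ signed b A → ρ ⊨ signed c B → ρ ⊨ signed (b ∨ c) (A ∨' B)
signed-∨ true  c     a b = ∨-introˡ a
signed-∨ false true  a b = ∨-introʳ b
signed-∨ false false a b = ¬-intro ([ ¬-elim a , ¬-elim b ]′ ∘ ∨-elim)

-- Derivations

tautology : (∀ {ρ} → ρ ⊨ A) → GR⁻⊢ A
tautology f = taut λ ρ → holds (f {ρ})

by₁ : GR⁻⊢ A → (∀ {ρ} → ρ ⊨ A → ρ ⊨ B) → GR⁻⊢ B
by₁ a f = mp (tautology (⇒-intro f)) a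

by₂ : GR⁻⊢ A → GR⁻⊢ B → (∀ {ρ} → ρ ⊨ A → ρ ⊨ B → ρ ⊨ C) → GR⁻⊢ C
by₂ a b f = mp (by₁ a λ a → ⇒-intro (f a)) b

by₃ : GR⁻⊢ A → GR⁻⊢ B → GR⁻⊢ C → (∀ {ρ} → ρ ⊨ A → ρ ⊨ B → ρ ⊨ C → ρ ⊨ D) → GR⁻⊢ D
by₃ a b c f = mp (by₂ a b λ a b → ⇒-intro (f a b)) c

⊢⋀ : ∀ {f : X → Form} xs → (∀ {x} → x ∈ xs → GR⁻⊢ f x) → GR⁻⊢ ⋀ f xs
⊢⋀ []       g = tautology ⟨ refl ⟩
⊢⋀ (x ∷ xs) g = by₂ (g (here refl)) (⊢⋀ xs (g ∘ there)) ∧-intro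

⇒-trans : GR⁻⊢ A ⇒ B → GR⁻⊢ B ⇒ C → GR⁻⊢ A ⇒ C
⇒-trans f g = by₂ f g λ f g → ⇒-intro (⇒-elim g ∘ ⇒-elim f)

weaken : GR⁻⊢ B → GR⁻⊢ A ⇒ B
weaken b = by₁ b λ b → ⇒-intro λ _ → b

⋁-mono : ∀ {f g : X → Form} xs → (∀ {x} → x ∈ xs → GR⁻⊢ f x ⇒ g x) → GR⁻⊢ ⋁ f xs ⇒ ⋁ g xs
⋁-mono xs h = by₁ (⊢⋀ xs h) λ c → ⇒-intro λ d →
  let _ , x∈ , a = ⋁-elim xs d in ⋁-intro x∈ (⇒-elim (⋀-elim c x∈) a)

□-mono : GR⁻⊢ A ⇒ B → GR⁻⊢ □ A ⇒ □ B
□-mono f = mp (axK _ _) (nec f)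

□-mono₂ : GR⁻⊢ A ⇒ B ⇒ C → GR⁻⊢ □ A ⇒ □ B ⇒ □ C
□-mono₂ f = by₂ (□-mono f) (axK _ _) λ f k → ⇒-intro λ a → ⇒-elim k (⇒-elim f a)

-- Transitivity passes through `□ (■ A)`, with `ax■□` applied under the box.
□-trans : GR⁻⊢ □ A ⇒ □ (□ A)
□-trans = ⇒-trans (ax□□■ _) (□-mono (ax■□ _))

◇-mono : GR⁻⊢ A ⇒ B → GR⁻⊢ ◇ A ⇒ ◇ B
◇-mono f = by₁ (□-mono (by₁ f λ f → ⇒-intro λ n → ¬-intro (¬-elim n ∘ ⇒-elim f)))
  λ g → ⇒-intro λ d → ¬-intro (¬-elim d ∘ ⇒-elim g)

□⊥-elim : GR⁻⊢ □ ⊥' ⇒ □ A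
□⊥-elim = □-mono (tautology (⇒-intro λ { ⟨ () ⟩ }))

-- Decidable equality of formulas and the enumeration of finite valuations

infix 4 _≟_

_≟_ : DecidableEquality Form
var p  ≟ var q  = map′ (cong var) (λ { refl → refl }) (p ≟ⁿ q)
⊥'     ≟ ⊥'     = yes refl
¬' A   ≟ ¬' B   = map′ (cong ¬'_) (λ { refl → refl }) (A ≟ B)
A ∨' B ≟ C ∨' D = map′ (λ { (refl , refl) → refl }) (λ { refl → refl , refl }) (A ≟ C ×-dec B ≟ D)
□ A    ≟ □ B    = map′ (cong □_) (λ { refl → refl }) (A ≟ B)
■ A    ≟ ■ B    = map′ (cong ■_) (λ { refl → refl }) (A ≟ B)
var _  ≟ ⊥'     = no λ ()
var _  ≟ ¬' _   = no λ ()
var _  ≟ _ ∨' _ = no λ ()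
var _  ≟ □ _    = no λ ()
var _  ≟ ■ _    = no λ ()
⊥'     ≟ var _  = no λ ()
⊥'     ≟ ¬' _   = no λ ()
⊥'     ≟ _ ∨' _ = no λ ()
⊥'     ≟ □ _    = no λ ()
⊥'     ≟ ■ _    = no λ ()
¬' _   ≟ var _  = no λ ()
¬' _   ≟ ⊥'     = no λ ()
¬' _   ≟ _ ∨' _ = no λ ()
¬' _   ≟ □ _    = no λ ()
¬' _   ≟ ■ _    = no λ ()
_ ∨' _ ≟ var _  = no λ ()
_ ∨' _ ≟ ⊥'     = no λ ()
_ ∨' _ ≟ ¬' _   = no λ ()
_ ∨' _ ≟ □ _    = no λ ()
_ ∨' _ ≟ ■ _    = no λ ()
□ _    ≟ var _  = no λ ()
□ _    ≟ ⊥'     = no λ ()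
□ _    ≟ ¬' _   = no λ ()
□ _    ≟ _ ∨' _ = no λ ()
□ _    ≟ ■ _    = no λ ()
■ _    ≟ var _  = no λ ()
■ _    ≟ ⊥'     = no λ ()
■ _    ≟ ¬' _   = no λ ()
■ _    ≟ _ ∨' _ = no λ ()
■ _    ≟ □ _    = no λ ()

open DecMembership _≟_ using () renaming (_∈?_ to _∈ᶠ?_)
open DecMembership _≟ⁿ_ using () renaming (_∈?_ to _∈ⁿ?_)

Valuation : Set
Valuation = Form → Bool

update : Form → Bool → Valuation → Valuation
update a b t c = if does (c ≟ a) then b else t c

valuations : List Form → List Valuation
valuations []       = (λ _ → false) ∷ []
valuations (a ∷ as) = map (update a true) (valuations as) ++ map (update a false) (valuations as)

update∈ : ∀ {a as t} b → t ∈ valuations as → update a b t ∈ valuations (a ∷ as)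
update∈         true  t∈ = ∈-++⁺ˡ (∈-map⁺ _ t∈)
update∈ {a} {as} false t∈ = ∈-++⁺ʳ (map (update a true) (valuations as)) (∈-map⁺ _ t∈)

valuations-complete : ∀ (ρ : Valuation) as → ∃ λ t → t ∈ valuations as × (∀ {a} → a ∈ as → t a ≡ ρ a)
valuations-complete ρ []       = _ , here refl , λ ()
valuations-complete ρ (a ∷ as) with valuations-complete ρ as
... | t , t∈ , agree = update a (ρ a) t , update∈ {as = as} (ρ a) t∈ , agree′
  where
  agree′ : ∀ {c} → c ∈ a ∷ as → update a (ρ a) t c ≡ ρ c
  agree′ {c} c∈ with c ≟ a | c∈
  ... | yes refl | _         = refl
  ... | no c≢a   | here c≡a  = contradiction c≡a c≢a
  ... | no _     | there c∈′ = agree c∈′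

-- The closure of a formula

rosserAxioms : Form → Form
rosserAxioms D =
  (■ D ⇒ □ D) ∧' ((□ D ⇒ □ (■ D)) ∧' ((□ D ⇒ (□ ⊥' ∨' ■ D)) ∧' (◇ (■ D) ⇒ ◇ D)))

⊢rosserAxioms : ∀ D → GR⁻⊢ rosserAxioms D
⊢rosserAxioms D = by₂ (by₂ (ax■□ D) (ax□□■ D) ∧-intro) (by₂ (ax□⊥■ D) (ax◇■ D) ∧-intro)
  λ c d → ∧-intro (∧-elimˡ c) (∧-intro (∧-elimʳ c) d)

boxBodies : Form → List Form
boxBodies (var p)  = []
boxBodies ⊥'       = []
boxBodies (¬' A)   = boxBodies A
boxBodies (A ∨' B) = boxBodies A ++ boxBodies B
boxBodies (□ A)    = A ∷ boxBodies A
-- A subformula ■ A contributes every box occurring in rosserAxioms A.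
boxBodies (■ A)    = ⊥' ∷ A ∷ ¬' A ∷ ■ A ∷ ¬' (■ A) ∷ boxBodies A

rosserBodies : Form → List Form
rosserBodies (var p)  = []
rosserBodies ⊥'       = []
rosserBodies (¬' A)   = rosserBodies A
rosserBodies (A ∨' B) = rosserBodies A ++ rosserBodies B
rosserBodies (□ A)    = rosserBodies A
rosserBodies (■ A)    = A ∷ rosserBodies A

module Closure (V : List ℕ) (L K : List Form) where

  -- `□ A` demands that `A` be closed too, because its truth at a type is compared with that of `A`
  -- at successors. `■ A` is an atom whose value the type supplies, so membership in `K` suffices.
  Closed : Form → Set
  Closed (var p)  = p ∈ V
  Closed ⊥'       = ⊤
  Closed (¬' A)   = Closed A
  Closed (A ∨' B) = Closed A × Closed B
  Closed (□ A)    = A ∈ L × Closed A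
  Closed (■ A)    = A ∈ K

  -- The first component lets a type decide the axioms for `D`; the second bounds the variables of a
  -- literal `■ D` in the interpolant.
  RosserClosed : Form → Set
  RosserClosed D = Closed (rosserAxioms D) × All (_∈ V) (vars D)

  -- `L` and `K` stay fixed while the induction descends into subformulas, hence the containment
  -- hypotheses.
  closed : ∀ A → All (_∈ V) (vars A) → All (_∈ L) (boxBodies A) → All (_∈ K) (rosserBodies A) →
    Closed A × All Closed (boxBodies A) × All RosserClosed (rosserBodies A)
  closed (var p) (p∈ ∷ []) l k = p∈ , [] , []
  closed ⊥' v l k = tt , [] , []
  closed (¬' A) v l k = closed A v l k
  closed (A ∨' B) v l k =
    let v₁ , v₂ = ++⁻ (vars A) v
        l₁ , l₂ = ++⁻ (boxBodies A) l
        k₁ , k₂ = ++⁻ (rosserBodies A) k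
        a , la , ka = closed A v₁ l₁ k₁
        b , lb , kb = closed B v₂ l₂ k₂
    in (a , b) , ++⁺ la lb , ++⁺ ka kb
  closed (□ A) v (A∈ ∷ l) k =
    let a , la , ka = closed A v l k in (A∈ , a) , a ∷ la , ka
  closed (■ A) v (⊥∈ ∷ A∈ ∷ ¬A∈ ∷ ■A∈ ∷ ¬■A∈ ∷ l) (A∈K ∷ k) =
    let a , la , ka = closed A v l k in
    A∈K , tt ∷ a ∷ a ∷ A∈K ∷ A∈K ∷ la ,
    (((A∈K , A∈ , a) , ((A∈ , a) , ■A∈ , A∈K) , ((A∈ , a) , (⊥∈ , tt) , A∈K) , (¬■A∈ , A∈K) , ¬A∈ , a) , v) ∷ ka

-- Counting false boxes, the measure for recursion on types

weight : Bool → ℕ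
weight b = if b then 0 else 1

weight-≤1 : ∀ b → weight b ≤ 1
weight-≤1 true  = z≤n
weight-≤1 false = ≤-refl

weight-anti : ∀ {b c} → (b ≡ true → c ≡ true) → weight c ≤ weight b
weight-anti {c = true}          _ = z≤n
weight-anti {false} {c = false} _ = ≤-refl
weight-anti {true}  {c = false} f with () ← f refl

count : List Form → Valuation → ℕ
count []      t = 0
count (B ∷ L) t = weight (t (□ B)) + count L t

count-≤-length : ∀ L t → count L t ≤ length L
count-≤-length []      t = z≤n
count-≤-length (B ∷ L) t = +-mono-≤ (weight-≤1 (t (□ B))) (count-≤-length L t)

count-≤ : ∀ {L t x} → All (λ B → t (□ B) ≡ true → x (□ B) ≡ true) L → count L x ≤ count L t
count-≤ []       = z≤n
count-≤ (f ∷ fs) = +-mono-≤ (weight-anti f) (count-≤ fs)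

count-< : ∀ {L B t x} → All (λ B → t (□ B) ≡ true → x (□ B) ≡ true) L →
  B ∈ L → t (□ B) ≡ false → x (□ B) ≡ true → count L x < count L t
count-< (f ∷ fs) (here refl) tB xB rewrite tB | xB = s≤s (count-≤ fs)
count-< (f ∷ fs) (there B∈)  tB xB = +-mono-≤-< (weight-anti f) (count-< fs B∈ tB xB)

module Interpolant (A : Form) (P : List ℕ) where

  V = vars A
  L = boxBodies A
  K = rosserBodies A

  open Closure V L K

  closure : Closed A × All Closed L × All RosserClosed K
  closure = closed A (All.tabulate id) (All.tabulate id) (All.tabulate id)

  PFree : Form → Set
  PFree B = All (_∉ P) (vars B)

  PFree? : ∀ B → Dec (PFree B)
  PFree? B = All.all? (λ p → ¬? (p ∈ⁿ? P)) (vars B)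

  -- Types

  Coherent : Valuation → Set
  Coherent t = All (λ D → eval t (rosserAxioms D) ≡ true) K

  Coherent? : ∀ t → Dec (Coherent t)
  Coherent? t = All.all? (λ D → eval t (rosserAxioms D) ≟ᵇ true) K

  atoms : List Form
  atoms = map var V ++ (map □_ L ++ map ■_ K)

  types : List Valuation
  types = filter Coherent? (valuations atoms)

  record _≺_ (t x : Valuation) : Set where
    constructor mk≺
    field ≺-all : All (λ B → t (□ B) ≡ true → eval x B ≡ true × x (□ B) ≡ true) L

  open _≺_

  _≺?_ : ∀ t x → Dec (t ≺ x)
  t ≺? x = map′ mk≺ ≺-all
    (All.all? (λ B → (t (□ B) ≟ᵇ true) →-dec ((eval x B ≟ᵇ true) ×-dec (x (□ B) ≟ᵇ true))) L)

  ≺-trans : ∀ {t x y} → t ≺ x → x ≺ y → t ≺ y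
  ≺-trans (mk≺ f) (mk≺ g) = mk≺ (All.zipWith (λ (f , g) b → g (proj₂ (f b))) (f , g))

  -- As `t ≺ x` implies `x ⊒ t`, a successor `x` with `t ⊒ x` has exactly the boxes of `t`.
  record _⊒_ (t x : Valuation) : Set where
    constructor mk⊒
    field ⊒-all : All (λ B → x (□ B) ≡ true → t (□ B) ≡ true) L

  open _⊒_

  abstract
    -- Abstract, so that `does (t ⊒? x)` does not unfold and a `with` on `t ⊒? x` reduces `step`.
    _⊒?_ : ∀ t x → Dec (t ⊒ x)
    t ⊒? x = map′ mk⊒ ⊒-all (All.all? (λ B → (x (□ B) ≟ᵇ true) →-dec (t (□ B) ≟ᵇ true)) L)

  ≺⇒⊒ : ∀ {t x} → t ≺ x → x ⊒ t
  ≺⇒⊒ (mk≺ f) = mk⊒ (All.map (proj₂ ∘_) f)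

  ⊒-trans : ∀ {t x y} → t ⊒ x → x ⊒ y → t ⊒ y
  ⊒-trans (mk⊒ f) (mk⊒ g) = mk⊒ (All.zipWith (λ (f , g) → f ∘ g) (f , g))

  ⊒-≺-trans : ∀ {t x y} → t ⊒ x → t ≺ y → x ≺ y
  ⊒-≺-trans (mk⊒ f) (mk≺ g) = mk≺ (All.zipWith (λ (f , g) → g ∘ f) (f , g))

  successors : Valuation → List Valuation
  successors t = filter (t ≺?_) types

  refutes? : ∀ B x → Dec (eval x B ≡ false × x (□ B) ≡ true)
  refutes? B x = (eval x B ≟ᵇ false) ×-dec (x (□ B) ≟ᵇ true)

  -- By Löb's rule a false □ B is witnessed by a successor in which B fails and □ B holds.
  witnesses : Valuation → Form → List Valuation
  witnesses t B = filter (refutes? B) (successors t)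

  ∈successors⁻ : ∀ {t x} → x ∈ successors t → x ∈ types × t ≺ x
  ∈successors⁻ {t} = ∈-filter⁻ (t ≺?_)

  successors-trans : ∀ {t x y} → x ∈ successors t → y ∈ successors x → y ∈ successors t
  successors-trans {t} {x} x∈ y∈ =
    let _ , t≺x = ∈successors⁻ {t} x∈
        y∈types , x≺y = ∈successors⁻ {x} y∈
    in ∈-filter⁺ (t ≺?_) y∈types (≺-trans t≺x x≺y)

  unboxed : Valuation → List Form
  unboxed t = filter (λ B → t (□ B) ≟ᵇ false) L

  rank : Valuation → ℕ
  rank = count L

  rank-≤ : ∀ {t x} → x ⊒ t → rank x ≤ rank t
  rank-≤ (mk⊒ f) = count-≤ f

  -- Boxes persist along `≺`, and the witness makes `□ B` true where `t` makes it false.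
  rank-witness : ∀ {t x B} → B ∈ unboxed t → x ∈ witnesses t B → rank x < rank t
  rank-witness {t} {x} {B} B∈ x∈ =
    let B∈L , tB = ∈-filter⁻ (λ B → t (□ B) ≟ᵇ false) B∈
        x∈succ , _ , xB = ∈-filter⁻ (refutes? B) x∈
    in count-< (⊒-all (≺⇒⊒ (proj₂ (∈successors⁻ {t} x∈succ)))) B∈L tB xB

  rank-strict : ∀ {t x} → t ≺ x → ¬ t ⊒ x → rank x < rank t
  rank-strict {t} {x} t≺x t⋣x
    with find (¬All⇒Any¬ (λ B → (x (□ B) ≟ᵇ true) →-dec (t (□ B) ≟ᵇ true)) L (t⋣x ∘ mk⊒))
  ... | B , B∈ , ¬f with t (□ B) in tB | x (□ B) in xB
  ...   | true  | _     = contradiction (λ _ → refl) ¬f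
  ...   | false | true  = count-< (⊒-all (≺⇒⊒ t≺x)) B∈ tB xB
  ...   | false | false = contradiction (λ ()) ¬f

  -- The interpolants of the types

  literals : Valuation → Form
  literals t = ⋀ (λ p → signed (t (var p)) (var p)) (filter (λ p → ¬? (p ∈ⁿ? P)) V)
            ∧' ⋀ (λ D → signed (t (■ D)) (■ D)) (filter PFree? K)

  forced : (Valuation → Form) → Valuation → Form
  forced F t = ⋀ (λ B → ◇ (⋁ F (witnesses t B))) (unboxed t)

  -- A successor with the same boxes as t has the same future as t, and future F t is transitive,
  -- so this conjunct of its interpolant may be omitted.
  step : (Valuation → Form) → Valuation → Valuation → Form
  step F t x = if does (t ⊒? x) then literals x ∧' forced F x else F x

  future : (Valuation → Form) → Valuation → Form
  future F t = □ (⋁ (step F t) (successors t))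

  body : (Valuation → Form) → Valuation → Form
  body F t = literals t ∧' (forced F t ∧' future F t)

  -- `body` consults its argument only at types of smaller rank, so recursion on fuel replaces
  -- well-founded recursion on rank.
  approx : ℕ → Valuation → Form
  -- A junk value, never reached when the initial fuel exceeds the rank of the type, as it does in
  -- `θ`.
  approx zero    t = ⊥'
  approx (suc n) t = body (approx n) t

  θ : Valuation → Form
  θ = approx (suc (length L))

  forced-cong : ∀ {F G} t → (∀ {x} → rank x < rank t → F x ≡ G x) → forced F t ≡ forced G t
  forced-cong t e = ⋀-cong (unboxed t) λ {B} B∈ →
    cong ◇_ (⋁-cong (witnesses t B) λ x∈ → e (rank-witness {t} B∈ x∈))

  body-cong : ∀ {F G} t → (∀ {x} → rank x < rank t → F x ≡ G x) → body F t ≡ body G t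
  body-cong {F} {G} t e = cong (literals t ∧'_) (cong₂ _∧'_ (forced-cong t e)
    (cong □_ (⋁-cong (successors t) λ x∈ → step-cong (proj₂ (∈successors⁻ {t} x∈)))))
    where
    step-cong : ∀ {x} → t ≺ x → step F t x ≡ step G t x
    step-cong {x} t≺x with t ⊒? x
    -- The rank of `x` need not be smaller than that of `t`, but the ranks of its witnesses are.
    ... | yes _  = cong (literals x ∧'_) (forced-cong x λ y<x → e (<-≤-trans y<x (rank-≤ (≺⇒⊒ t≺x))))
    ... | no t⋣x = e (rank-strict t≺x t⋣x)

  approx-stable : ∀ m n {t} → rank t < m → rank t < n → approx m t ≡ approx n t
  approx-stable (suc m) (suc n) {t} (s≤s t≤m) (s≤s t≤n) =
    body-cong t λ x<t → approx-stable m n (<-≤-trans x<t t≤m) (<-≤-trans x<t t≤n)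

  -- Both fuels, `length L` and `suc (length L)`, exceed every rank below that of `t`.
  θ-unfold : ∀ t → θ t ≡ body θ t
  θ-unfold t = body-cong t λ {x} x<t →
    let x<L = <-≤-trans x<t (count-≤-length L t) in
    approx-stable (length L) (suc (length L)) x<L (s≤s (count-≤-length L x))

  -- Provable consequences of `θ`

  θ⇒body : ∀ t → GR⁻⊢ θ t ⇒ body θ t
  θ⇒body t = subst (λ C → GR⁻⊢ C ⇒ body θ t) (sym (θ-unfold t)) (tautology (⇒-intro id))

  body⇒θ : ∀ t → GR⁻⊢ body θ t ⇒ θ t
  body⇒θ t = subst (λ C → GR⁻⊢ body θ t ⇒ C) (sym (θ-unfold t)) (tautology (⇒-intro id))

  θ⇒literals : ∀ t → GR⁻⊢ θ t ⇒ literals t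
  θ⇒literals t = by₁ (θ⇒body t) λ f → ⇒-intro (∧-elimˡ ∘ ⇒-elim f)

  θ⇒◇ : ∀ t {B} → B ∈ L → t (□ B) ≡ false → GR⁻⊢ θ t ⇒ ◇ (⋁ θ (witnesses t B))
  θ⇒◇ t B∈ tB = by₁ (θ⇒body t) λ f → ⇒-intro λ a →
    ⋀-elim (∧-elimˡ (∧-elimʳ (⇒-elim f a))) (∈-filter⁺ (λ B → t (□ B) ≟ᵇ false) B∈ tB)

  -- `t` and `x` have the same boxes, so they compare alike with `y` and the mixed cases are absurd.
  step-transfer : ∀ {t x y} → t ≺ x → t ⊒ x → ρ ⊨ step θ t y → ρ ⊨ step θ x y
  step-transfer {t = t} {x} {y} t≺x t⊒x a with t ⊒? y | x ⊒? y
  ... | yes _   | yes _   = a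
  ... | no _    | no _    = a
  ... | yes t⊒y | no x⋣y  = contradiction (⊒-trans (≺⇒⊒ t≺x) t⊒y) x⋣y
  ... | no t⋣y  | yes x⊒y = contradiction (⊒-trans t⊒x x⊒y) t⋣y

  future-transfer : ∀ {t x} → t ≺ x → t ⊒ x → GR⁻⊢ future θ t ⇒ future θ x
  future-transfer {t} {x} t≺x t⊒x = □-mono (tautology (⇒-intro λ d →
    let y , y∈ , a = ⋁-elim (successors t) d
        y∈types , t≺y = ∈successors⁻ {t} y∈
    in ⋁-intro (∈-filter⁺ (x ≺?_) y∈types (⊒-≺-trans t⊒x t≺y)) (step-transfer {t = t} {x} {y} t≺x t⊒x a)))

  -- In the circular case `step` lacks only `future θ x`, which `future-transfer` supplies.
  step⇒θ : ∀ {t x} → t ≺ x → GR⁻⊢ future θ t ⇒ step θ t x ⇒ θ x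
  step⇒θ {t} {x} t≺x with t ⊒? x
  ... | no _    = tautology (⇒-intro λ _ → ⇒-intro id)
  ... | yes t⊒x = by₂ (future-transfer t≺x t⊒x) (body⇒θ x) λ f g → ⇒-intro λ n → ⇒-intro λ a →
    ⇒-elim g (∧-intro (∧-elimˡ a) (∧-intro (∧-elimʳ a) (⇒-elim f n)))

  -- `future θ t` is needed again inside the box, to complete each `step` to a `θ`; `□-trans`
  -- carries it there.
  θ⇒□ : ∀ t → GR⁻⊢ θ t ⇒ □ (⋁ θ (successors t))
  θ⇒□ t = by₃ (θ⇒body t) □-trans (□-mono₂ steps) λ f g h → ⇒-intro λ a →
    let n = ∧-elimʳ (∧-elimʳ (⇒-elim f a)) in ⇒-elim (⇒-elim h (⇒-elim g n)) n
    where
    steps : GR⁻⊢ future θ t ⇒ ⋁ (step θ t) (successors t) ⇒ ⋁ θ (successors t)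
    steps = by₁ (⊢⋀ {f = λ x → future θ t ⇒ step θ t x ⇒ θ x} (successors t)
                    λ x∈ → step⇒θ (proj₂ (∈successors⁻ {t} x∈)))
      λ c → ⇒-intro λ n → ⇒-intro λ d →
        let _ , x∈ , a = ⋁-elim (successors t) d
        in ⋁-intro x∈ (⇒-elim (⇒-elim (⋀-elim c x∈) n) a)

  -- Diagrams

  diagram : Valuation → Form
  diagram t = ⋀ (λ a → signed (t a) a) atoms

  eval-diagram : ∀ {t} B → Closed B → ρ ⊨ diagram t → eval ρ B ≡ eval t B
  eval-diagram (var p) p∈ d = eval-signed _ (⋀-elim d (∈-++⁺ˡ (∈-map⁺ var p∈)))
  eval-diagram ⊥' _ d = refl
  eval-diagram (¬' B) b d = cong not (eval-diagram B b d)
  eval-diagram (B ∨' C) (b , c) d = cong₂ _∨_ (eval-diagram B b d) (eval-diagram C c d)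
  eval-diagram (□ B) (B∈ , _) d = eval-signed _ (⋀-elim d (∈-++⁺ʳ (map var V) (∈-++⁺ˡ (∈-map⁺ □_ B∈))))
  eval-diagram (■ B) B∈ d =
    eval-signed _ (⋀-elim d (∈-++⁺ʳ (map var V) (∈-++⁺ʳ (map □_ L) (∈-map⁺ ■_ B∈))))

  diagram⇒signed : ∀ t {B} → Closed B → GR⁻⊢ diagram t ⇒ signed (eval t B) B
  diagram⇒signed t {B} b = tautology λ {ρ} → ⇒-intro λ d →
    subst (λ v → ρ ⊨ signed v B) (eval-diagram B b d) (signed-eval B)

  diagram⇒true : ∀ t {B} → Closed B → eval t B ≡ true → GR⁻⊢ diagram t ⇒ B
  diagram⇒true t {B} b e = subst (λ v → GR⁻⊢ diagram t ⇒ signed v B) e (diagram⇒signed t {B} b)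

  diagram⇒false : ∀ t {B} → Closed B → eval t B ≡ false → GR⁻⊢ diagram t ⇒ ¬' B
  diagram⇒false t {B} b e = subst (λ v → GR⁻⊢ diagram t ⇒ signed v B) e (diagram⇒signed t {B} b)

  closedBox : ∀ {B} → B ∈ L → Closed (□ B)
  closedBox B∈ = B∈ , All.lookup (proj₁ (proj₂ closure)) B∈

  closedRosser : ∀ {D} → D ∈ K → Closed (rosserAxioms D)
  closedRosser D∈ = proj₁ (All.lookup (proj₂ (proj₂ closure)) D∈)

  -- A valuation satisfying the Rosser axioms for `K` agrees on the atoms with a listed one, which
  -- is then coherent. So the disjunction follows propositionally from those axioms.
  ⊢diagrams : GR⁻⊢ ⋁ diagram types
  ⊢diagrams = by₁ (⊢⋀ K λ {D} _ → ⊢rosserAxioms D) cover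
    where
    atomic : ∀ {a} → a ∈ atoms → eval ρ a ≡ ρ a
    atomic a∈ with ∈-++⁻ (map var V) a∈
    ... | inj₁ a∈ with _ , _ , refl ← ∈-map⁻ var a∈ = refl
    ... | inj₂ a∈ with ∈-++⁻ (map □_ L) a∈
    ...   | inj₁ a∈ with _ , _ , refl ← ∈-map⁻ □_ a∈ = refl
    ...   | inj₂ a∈ with _ , _ , refl ← ∈-map⁻ ■_ a∈ = refl

    cover : ρ ⊨ ⋀ rosserAxioms K → ρ ⊨ ⋁ diagram types
    cover {ρ} c =
      let t , t∈ , agree = valuations-complete ρ atoms
          d = ⋀-intro atoms λ {a} a∈ →
            subst (λ v → ρ ⊨ signed v a) (trans (atomic a∈) (sym (agree a∈))) (signed-eval a)
          coherent = All.tabulate λ {D} D∈ →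
            trans (sym (eval-diagram (rosserAxioms D) (closedRosser D∈) d)) (holds (⋀-elim c D∈))
      in ⋁-intro (∈-filter⁺ Coherent? t∈ coherent) d

  boxed : Valuation → List Form
  boxed t = filter (λ B → t (□ B) ≟ᵇ true) L

  inherited : Valuation → Form
  inherited t = ⋀ (λ B → B ∧' (□ B)) (boxed t)

  diagram⇒□inherited : ∀ t → GR⁻⊢ diagram t ⇒ □ (inherited t)
  diagram⇒□inherited t = □⋀ (boxed t) λ {B} B∈ →
    let B∈L , tB = ∈-filter⁻ (λ B → t (□ B) ≟ᵇ true) B∈ in
    by₃ (diagram⇒true t (closedBox B∈L) tB) □-trans
        (□-mono₂ (tautology (⇒-intro λ b → ⇒-intro λ c → ∧-intro b c)))
        λ f g h → ⇒-intro λ d → let b = ⇒-elim f d in ⇒-elim (⇒-elim h b) (⇒-elim g b)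
    where
    □⋀ : ∀ {f : Form → Form} {C} Bs → (∀ {B} → B ∈ Bs → GR⁻⊢ C ⇒ □ (f B)) → GR⁻⊢ C ⇒ □ (⋀ f Bs)
    □⋀ []       g = weaken (nec (tautology ⟨ refl ⟩))
    □⋀ (B ∷ Bs) g = by₃ (g (here refl)) (□⋀ Bs (g ∘ there))
      (□-mono₂ (tautology (⇒-intro λ a → ⇒-intro λ b → ∧-intro a b)))
      λ f g h → ⇒-intro λ c → ⇒-elim (⇒-elim h (⇒-elim f c)) (⇒-elim g c)

  inherited-diagram : ∀ t → ρ ⊨ inherited t → ρ ⊨ ⋁ diagram types →
    ∃ λ x → x ∈ successors t × ρ ⊨ diagram x
  inherited-diagram t i c =
    let x , x∈ , d = ⋁-elim types c
        t≺x = mk≺ (All.tabulate λ {B} B∈ tB →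
          let b = ⋀-elim i (∈-filter⁺ (λ B → t (□ B) ≟ᵇ true) B∈ tB)
              cl = closedBox B∈
          in trans (sym (eval-diagram B (proj₂ cl) d)) (holds (∧-elimˡ b)) ,
             trans (sym (eval-diagram (□ B) cl d)) (holds (∧-elimʳ {A = B} b)))
    in x , ∈-filter⁺ (t ≺?_) x∈ t≺x , d

  diagram⇒□ : ∀ t → GR⁻⊢ diagram t ⇒ □ (⋁ diagram (successors t))
  diagram⇒□ t = ⇒-trans (diagram⇒□inherited t) (□-mono (by₁ ⊢diagrams λ c → ⇒-intro λ i →
    let _ , x∈ , d = inherited-diagram t i c in ⋁-intro x∈ d))

  -- If every accessible world avoided the witnesses, `□ B ⇒ B` would hold at all of them. Löb's
  -- axiom would then give `□ B`, against the diagram of `t`.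
  diagram⇒◇ : ∀ t {B} → B ∈ unboxed t → GR⁻⊢ diagram t ⇒ ◇ (⋁ diagram (witnesses t B))
  diagram⇒◇ t {B} B∈ =
    let B∈L , tB = ∈-filter⁻ (λ B → t (□ B) ≟ᵇ false) B∈
        cl = closedBox B∈L
        löb : GR⁻⊢ inherited t ⇒ ¬' (⋁ diagram (witnesses t B)) ⇒ (□ B ⇒ B)
        löb = by₁ ⊢diagrams λ {ρ} c → ⇒-intro λ i → ⇒-intro λ n → ⇒-intro λ b → ¬¬-elim λ ¬B →
          let x , x∈ , d = inherited-diagram t i c
              xB = trans (sym (eval-diagram B (proj₂ cl) d)) (¬-not (¬B ∘ ⟨_⟩))
              x□B = trans (sym (eval-diagram (□ B) cl d)) (holds b)
          in ¬-elim n (⋁-intro (∈-filter⁺ (refutes? B) x∈ (xB , x□B)) d)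
    in by₃ (diagram⇒□inherited t) (diagram⇒false t cl tB) (by₂ (□-mono₂ löb) (axL B) ∧-intro)
      λ f g h → ⇒-intro λ d → ¬-intro λ n →
        ¬-elim (⇒-elim g d) (⇒-elim (∧-elimʳ h) (⇒-elim (⇒-elim (∧-elimˡ h) (⇒-elim f d)) n))

  diagram⇒literals : ∀ t → GR⁻⊢ diagram t ⇒ literals t
  diagram⇒literals t = tautology (⇒-intro λ d → ∧-intro
    (⋀-intro _ λ p∈ → ⋀-elim d (∈-++⁺ˡ (∈-map⁺ var (proj₁ (∈-filter⁻ (λ p → ¬? (p ∈ⁿ? P)) {xs = V} p∈)))))
    (⋀-intro _ λ D∈ → ⋀-elim d (∈-++⁺ʳ (map var V) (∈-++⁺ʳ (map □_ L)
      (∈-map⁺ ■_ (proj₁ (∈-filter⁻ PFree? {xs = K} D∈)))))))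

  diagram⇒forced : ∀ t → (∀ {x} → rank x < rank t → GR⁻⊢ diagram x ⇒ θ x) → GR⁻⊢ diagram t ⇒ forced θ t
  diagram⇒forced t ih = by₁ (⊢⋀ {f = λ B → diagram t ⇒ ◇ (⋁ θ (witnesses t B))} (unboxed t) λ {B} B∈ →
      ⇒-trans (diagram⇒◇ t B∈) (◇-mono (⋁-mono (witnesses t B) λ x∈ → ih (rank-witness {t} B∈ x∈))))
    λ c → ⇒-intro λ d → ⋀-intro (unboxed t) λ B∈ → ⇒-elim (⋀-elim c B∈) d

  -- The circular case asks only for `literals` and `forced`, so the hypothesis at smaller ranks
  -- suffices.
  diagram⇒step : ∀ {t x} → t ≺ x → (∀ {x} → rank x < rank t → GR⁻⊢ diagram x ⇒ θ x) →
    GR⁻⊢ diagram x ⇒ step θ t x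
  diagram⇒step {t} {x} t≺x ih with t ⊒? x
  ... | no t⋣x = ih (rank-strict t≺x t⋣x)
  ... | yes _  = by₂ (diagram⇒literals x)
      (diagram⇒forced x λ y<x → ih (<-≤-trans y<x (rank-≤ (≺⇒⊒ t≺x))))
      λ f g → ⇒-intro λ d → ∧-intro (⇒-elim f d) (⇒-elim g d)

  diagram⇒θ-below : ∀ n {t} → rank t < n → GR⁻⊢ diagram t ⇒ θ t
  diagram⇒θ-below (suc n) {t} (s≤s t≤n) = ⇒-trans (by₃ (diagram⇒literals t) (diagram⇒forced t ih)
      (⇒-trans (diagram⇒□ t) (□-mono (⋁-mono (successors t) λ x∈ →
        diagram⇒step (proj₂ (∈successors⁻ {t} x∈)) ih)))
      λ f g h → ⇒-intro λ d → ∧-intro (⇒-elim f d) (∧-intro (⇒-elim g d) (⇒-elim h d)))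
    (body⇒θ t)
    where
    ih : ∀ {x} → rank x < rank t → GR⁻⊢ diagram x ⇒ θ x
    ih x<t = diagram⇒θ-below n (<-≤-trans x<t t≤n)

  diagram⇒θ : ∀ t → GR⁻⊢ diagram t ⇒ θ t
  diagram⇒θ t = diagram⇒θ-below (suc (rank t)) ≤-refl

  -- The product translation

  -- The box of the product: a successor of (world, `t`) pairs an accessible world satisfying `θ x`
  -- with a successor type `x` of `t`.
  □ᵗ : (Valuation → Form) → Valuation → Form
  □ᵗ F t = □ (⋀ (λ x → θ x ⇒ F x) (successors t))

  constant : Bool → Form
  constant true  = ⊤'
  constant false = ⊥'

  -- For ■ B with neither a value in the type nor a meaning in the original model, interpreting ■ B
  -- at dead ends as B satisfies the axioms.
  defaultRosser : (Valuation → Form) → Valuation → Form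
  defaultRosser F t = ((□ ⊥') ∧' F t) ∨' ((¬' (□ ⊥')) ∧' □ᵗ F t)

  tr : Form → Valuation → Form
  tr (var p)  t = if does (p ∈ⁿ? P) then constant (t (var p)) else var p
  tr ⊥'       t = ⊥'
  tr (¬' B)   t = ¬' (tr B t)
  tr (B ∨' C) t = tr B t ∨' tr C t
  tr (□ B)    t = □ᵗ (tr B) t
  -- The first test takes priority even when `B` is in `K`: keeping `■ B` serves `tr-PFree`, and the
  -- second conjunct of `literals` matches it with the type.
  tr (■ B)    t = if does (PFree? B) then ■ B
             else if does (B ∈ᶠ? K) then constant (t (■ B))
             else defaultRosser (tr B) t

  constant-signed : ∀ b → ρ ⊨ signed b (constant b)
  constant-signed true  = ⟨ refl ⟩
  constant-signed false = ⟨ refl ⟩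

  -- A truth lemma: `literals` settles the atoms that `tr` keeps, `≺` the true boxes, and the
  -- witnesses from `θ⇒◇` the false ones.
  tr-closed : ∀ B t → Closed B → GR⁻⊢ θ t ⇒ signed (eval t B) (tr B t)
  tr-closed (var p) t p∈ with p ∈ⁿ? P
  ... | yes _  = tautology (⇒-intro λ _ → constant-signed (t (var p)))
  ... | no p∉P = by₁ (θ⇒literals t) λ f → ⇒-intro λ a →
    ⋀-elim (∧-elimˡ (⇒-elim f a)) (∈-filter⁺ (λ p → ¬? (p ∈ⁿ? P)) p∈ p∉P)
  tr-closed ⊥' t _ = tautology (⇒-intro λ _ → ⟨ refl ⟩)
  tr-closed (¬' B) t b = by₁ (tr-closed B t b) λ f → ⇒-intro λ a → signed-¬ (eval t B) (⇒-elim f a)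
  tr-closed (B ∨' C) t (b , c) = by₂ (tr-closed B t b) (tr-closed C t c) λ f g → ⇒-intro λ a →
    signed-∨ (eval t B) (eval t C) (⇒-elim f a) (⇒-elim g a)
  tr-closed (□ B) t (B∈ , b) with t (□ B) in tB
  ... | true  = weaken (nec (⊢⋀ (successors t) λ {x} x∈ →
    let xB = proj₁ (All.lookup (≺-all (proj₂ (∈successors⁻ {t} x∈))) B∈ tB)
    in subst (λ v → GR⁻⊢ θ x ⇒ signed v (tr B x)) xB (tr-closed B x b)))
  ... | false = by₂ (θ⇒◇ t B∈ tB) (□-mono none) λ f g → ⇒-intro λ a → ¬-intro λ n →
    ¬-elim (⇒-elim f a) (⇒-elim g n)
    where
    none : GR⁻⊢ ⋀ (λ x → θ x ⇒ tr B x) (successors t) ⇒ ¬' (⋁ θ (witnesses t B))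
    none = by₁ (⊢⋀ {f = λ x → θ x ⇒ ¬' (tr B x)} (witnesses t B) λ {x} x∈ →
        subst (λ v → GR⁻⊢ θ x ⇒ signed v (tr B x))
          (proj₁ (proj₂ (∈-filter⁻ (refutes? B) {xs = successors t} x∈))) (tr-closed B x b))
      λ c → ⇒-intro λ i → ¬-intro λ d →
        let _ , x∈ , a = ⋁-elim (witnesses t B) d
            x∈succ = proj₁ (∈-filter⁻ (refutes? B) {xs = successors t} x∈)
        in ¬-elim (⇒-elim (⋀-elim c x∈) a) (⇒-elim (⋀-elim i x∈succ) a)
  tr-closed (■ B) t B∈ with PFree? B | B ∈ᶠ? K
  ... | yes pf | _      = by₁ (θ⇒literals t) λ f → ⇒-intro λ a →
    ⋀-elim (∧-elimʳ (⇒-elim f a)) (∈-filter⁺ PFree? B∈ pf)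
  ... | no _   | yes _  = tautology (⇒-intro λ _ → constant-signed (t (■ B)))
  ... | no _   | no B∉  = contradiction B∈ B∉

  -- The box case is a bisimulation argument: by `θ⇒□` every accessible world satisfies `θ x` for
  -- some successor type `x`, so the product box misses none.
  tr-PFree : ∀ B t → PFree B → GR⁻⊢ θ t ⇒ (tr B t ⇔ B)
  tr-PFree (var p) t (p∉P ∷ []) with p ∈ⁿ? P
  ... | yes p∈P = contradiction p∈P p∉P
  ... | no _    = tautology (⇒-intro λ _ → ⇔-intro id id)
  tr-PFree ⊥' t _ = tautology (⇒-intro λ _ → ⇔-intro id id)
  tr-PFree (¬' B) t pf = by₁ (tr-PFree B t pf) λ f → ⇒-intro λ a →
    ⇔-intro (λ n → ¬-intro (¬-elim n ∘ ⇔-elimʳ (⇒-elim f a)))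
            (λ n → ¬-intro (¬-elim n ∘ ⇔-elimˡ (⇒-elim f a)))
  tr-PFree (B ∨' C) t pf =
    let pfB , pfC = ++⁻ (vars B) pf in
    by₂ (tr-PFree B t pfB) (tr-PFree C t pfC) λ f g → ⇒-intro λ a →
      ⇔-intro ([ ∨-introˡ ∘ ⇔-elimˡ (⇒-elim f a) , ∨-introʳ ∘ ⇔-elimˡ (⇒-elim g a) ]′ ∘ ∨-elim)
              ([ ∨-introˡ ∘ ⇔-elimʳ (⇒-elim f a) , ∨-introʳ ∘ ⇔-elimʳ (⇒-elim g a) ]′ ∘ ∨-elim)
  tr-PFree (□ B) t pf = by₃ (θ⇒□ t) (□-mono₂ forth) (□-mono back) λ f g h → ⇒-intro λ a →
    ⇔-intro (⇒-elim (⇒-elim g (⇒-elim f a))) (⇒-elim h)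
    where
    ih : GR⁻⊢ ⋀ (λ x → θ x ⇒ (tr B x ⇔ B)) (successors t)
    ih = ⊢⋀ (successors t) λ {x} _ → tr-PFree B x pf

    forth : GR⁻⊢ ⋁ θ (successors t) ⇒ ⋀ (λ x → θ x ⇒ tr B x) (successors t) ⇒ B
    forth = by₁ ih λ c → ⇒-intro λ d → ⇒-intro λ i →
      let _ , x∈ , a = ⋁-elim (successors t) d
      in ⇔-elimˡ (⇒-elim (⋀-elim c x∈) a) (⇒-elim (⋀-elim i x∈) a)

    back : GR⁻⊢ B ⇒ ⋀ (λ x → θ x ⇒ tr B x) (successors t)
    back = by₁ ih λ c → ⇒-intro λ b → ⋀-intro (successors t) λ x∈ → ⇒-intro λ a →
      ⇔-elimʳ (⇒-elim (⋀-elim c x∈) a) b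
  tr-PFree (■ B) t pf with PFree? B
  ... | yes _  = tautology (⇒-intro λ _ → ⇔-intro id id)
  ... | no ¬pf = contradiction pf ¬pf

  -- `tr` commutes with the Boolean connectives, so a tautology may be evaluated at the valuation
  -- induced by `tr` at `t`.
  eval-tr : ∀ t B → eval ρ (tr B t) ≡ eval (λ C → eval ρ (tr C t)) B
  eval-tr t (var p)  = refl
  eval-tr t ⊥'       = refl
  eval-tr t (¬' B)   = cong not (eval-tr t B)
  eval-tr t (B ∨' C) = cong₂ _∨_ (eval-tr t B) (eval-tr t C)
  eval-tr t (□ B)    = refl
  eval-tr t (■ B)    = refl

  -- The translation of a derivation

  -- The world stays and only the type moves; by transitivity of `≺` no new successors appear.
  □ᵗ-trans : ∀ F {t x} → x ∈ successors t → GR⁻⊢ □ᵗ F t ⇒ □ᵗ F x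
  □ᵗ-trans F {t} {x} x∈ = □-mono (tautology (⇒-intro λ c →
    ⋀-intro (successors x) λ y∈ → ⋀-elim c (successors-trans {t} {x} x∈ y∈)))

  -- The premise may use `□ᵗ F x`: `□-trans` moves the box to the next world and `□ᵗ-trans` to the
  -- next type.
  □ᵗ-mono : ∀ {F G t} → (∀ {x} → GR⁻⊢ □ᵗ F x ⇒ θ x ⇒ F x ⇒ G x) → GR⁻⊢ □ᵗ F t ⇒ □ᵗ G t
  □ᵗ-mono {F} {G} {t} h = by₂ □-trans (□-mono₂ pointwise) λ f g → ⇒-intro λ b →
    ⇒-elim (⇒-elim g (⇒-elim f b)) b
    where
    pointwise : GR⁻⊢ □ᵗ F t ⇒ ⋀ (λ x → θ x ⇒ F x) (successors t) ⇒ ⋀ (λ x → θ x ⇒ G x) (successors t)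
    pointwise = by₁ (⊢⋀ {f = λ x → □ᵗ F t ⇒ θ x ⇒ F x ⇒ G x} (successors t)
                        λ x∈ → ⇒-trans (□ᵗ-trans F {t} x∈) h)
      λ c → ⇒-intro λ b → ⇒-intro λ i → ⋀-intro (successors t) λ x∈ → ⇒-intro λ a →
        ⇒-elim (⇒-elim (⇒-elim (⋀-elim c x∈) b) a) (⇒-elim (⋀-elim i x∈) a)

  □ᵗ-K : ∀ F G t → GR⁻⊢ □ᵗ (λ x → F x ⇒ G x) t ⇒ (□ᵗ F t ⇒ □ᵗ G t)
  □ᵗ-K F G t = □-mono₂ (tautology (⇒-intro λ c → ⇒-intro λ d →
    ⋀-intro (successors t) λ x∈ → ⇒-intro λ a →
      ⇒-elim (⇒-elim (⋀-elim c x∈) a) (⇒-elim (⋀-elim d x∈) a)))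

  -- `□ᵗ F t` is the plain box of one formula Φ. By `□ᵗ-trans` the hypothesis yields `□ (□ Φ ⇒ Φ)`,
  -- and `axL` applies.
  □ᵗ-löb : ∀ F t → GR⁻⊢ □ᵗ (λ x → □ᵗ F x ⇒ F x) t ⇒ □ᵗ F t
  □ᵗ-löb F t = ⇒-trans (□-mono (by₁ (⊢⋀ {f = λ x → □ᵗ F t ⇒ □ᵗ F x} (successors t) (□ᵗ-trans F {t}))
      λ c → ⇒-intro λ i → ⇒-intro λ b → ⋀-intro (successors t) λ x∈ → ⇒-intro λ a →
        ⇒-elim (⇒-elim (⋀-elim i x∈) a) (⇒-elim (⋀-elim c x∈) b)))
    (axL _)

  □ᵗ-nec : ∀ {F} t → (∀ {x} → x ∈ types → GR⁻⊢ θ x ⇒ F x) → GR⁻⊢ □ᵗ F t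
  □ᵗ-nec t f = nec (⊢⋀ (successors t) λ x∈ → f (proj₁ (∈successors⁻ {t} x∈)))

  -- Every accessible world realises a successor type, by `θ⇒□`, and there `F` clashes with its
  -- negation.
  □ᵗ-D : ∀ F t → GR⁻⊢ θ t ⇒ □ᵗ F t ⇒ □ᵗ (λ x → ¬' (F x)) t ⇒ □ ⊥'
  □ᵗ-D F t = by₃ (θ⇒□ t) (□-mono₂ clash) (axK _ _) λ f g h →
    ⇒-intro λ a → ⇒-intro λ b → ⇒-intro λ c →
      ⇒-elim (⇒-elim h (⇒-elim (⇒-elim g b) c)) (⇒-elim f a)
    where
    clash : GR⁻⊢ ⋀ (λ x → θ x ⇒ F x) (successors t) ⇒ ⋀ (λ x → θ x ⇒ ¬' (F x)) (successors t) ⇒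
              (⋁ θ (successors t) ⇒ ⊥')
    clash = tautology (⇒-intro λ c → ⇒-intro λ d → ⇒-intro λ e →
      let _ , x∈ , a = ⋁-elim (successors t) e
      in ⊥-elim (¬-elim (⇒-elim (⋀-elim d x∈) a) (⇒-elim (⋀-elim c x∈) a)))

  -- `F` and `G` stand for `tr D` and `tr (■ D)`; the equation is a parameter because it holds only
  -- when both tests in `tr` fail.
  module Default (F G : Valuation → Form) (G≡ : ∀ t → G t ≡ defaultRosser F t) where

    G-intro : ∀ {t} → ρ ⊨ (□ ⊥') ∧' F t ⊎ ρ ⊨ (¬' (□ ⊥')) ∧' □ᵗ F t → ρ ⊨ G t
    G-intro {ρ} {t} g = subst (ρ ⊨_) (sym (G≡ t)) ([ ∨-introˡ , ∨-introʳ ]′ g)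

    G-elim : ∀ {t} → ρ ⊨ G t → ρ ⊨ (□ ⊥') ∧' F t ⊎ ρ ⊨ (¬' (□ ⊥')) ∧' □ᵗ F t
    G-elim {ρ} {t} g = ∨-elim (subst (ρ ⊨_) (G≡ t) g)

    G⇒□ : ∀ t → GR⁻⊢ G t ⇒ □ᵗ F t
    G⇒□ t = by₁ □⊥-elim λ f → ⇒-intro λ g →
      [ (λ c → ⇒-elim f (∧-elimˡ c)) , ∧-elimʳ ]′ (G-elim {t = t} g)

    -- Both possible values of `G` are at hand at a successor: `F` itself, and `□ᵗ F` inherited from
    -- `t`.
    □⇒□G : ∀ t → GR⁻⊢ □ᵗ F t ⇒ □ᵗ G t
    □⇒□G t = □ᵗ-mono λ {x} → tautology λ {ρ} → ⇒-intro λ b → ⇒-intro λ _ → ⇒-intro λ c →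
      G-intro {t = x} (case-□⊥ b c)
      where
      case-□⊥ : ρ ⊨ B → ρ ⊨ C → ρ ⊨ (□ ⊥') ∧' C ⊎ ρ ⊨ (¬' (□ ⊥')) ∧' B
      case-□⊥ {ρ} b c with ρ ⊨? (□ ⊥')
      ... | yes d = inj₁ (∧-intro d c)
      ... | no ¬d = inj₂ (∧-intro (¬-intro ¬d) b)

    □⇒□⊥∨G : ∀ t → GR⁻⊢ □ᵗ F t ⇒ (□ᵗ (λ _ → ⊥') t ∨' G t)
    □⇒□⊥∨G t = by₁ □⊥-elim λ f → ⇒-intro λ b → ¬¬-elim λ n →
      n (∨-introʳ (G-intro {t = t} (inj₂ (∧-intro (¬-intro λ d → n (∨-introˡ (⇒-elim f d))) b))))

    -- The contrapositive of `ax◇■`. At a dead end `G` amounts to `F`; elsewhere it gives `□ᵗ F`,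
    -- which clashes with the inherited box of the negation by `□ᵗ-D`.
    □¬⇒□¬G : ∀ t → GR⁻⊢ □ᵗ (λ x → ¬' (F x)) t ⇒ □ᵗ (λ x → ¬' (G x)) t
    □¬⇒□¬G t = □ᵗ-mono λ {x} → by₁ (□ᵗ-D F x) λ f → ⇒-intro λ b → ⇒-intro λ a → ⇒-intro λ n →
      ¬-intro λ g →
        [ (λ c → ¬-elim n (∧-elimʳ c))
        , (λ c → ¬-elim (∧-elimˡ c) (⇒-elim (⇒-elim (⇒-elim f a) (∧-elimʳ c)) b)) ]′ (G-elim {t = x} g)

  tr-rosser-cases : ∀ D → PFree D ⊎ D ∈ K ⊎ (∀ t → tr (■ D) t ≡ defaultRosser (tr D) t)
  tr-rosser-cases D with PFree? D | D ∈ᶠ? K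
  ... | yes pf | _      = inj₁ pf
  ... | no _   | yes D∈ = inj₂ (inj₁ D∈)
  ... | no _   | no _   = inj₂ (inj₂ λ _ → refl)

  -- The axioms come from the logic itself when `D` avoids `P`, from coherence of `t` when `D` is in
  -- `K`, and from `Default` otherwise.
  tr-rosserAxioms : ∀ D {t} → t ∈ types → GR⁻⊢ θ t ⇒ tr (rosserAxioms D) t
  tr-rosserAxioms D {t} t∈ with tr-rosser-cases D
  ... | inj₁ pf = by₂ (⊢rosserAxioms D) (tr-PFree (rosserAxioms D) t pf′) λ a f →
      ⇒-intro λ b → ⇔-elimʳ (⇒-elim f b) a
    where
    pf′ : PFree (rosserAxioms D)
    pf′ = ++⁺ (++⁺ pf pf) (++⁺ (++⁺ pf pf) (++⁺ (++⁺ pf pf) (++⁺ pf pf)))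
  ... | inj₂ (inj₁ D∈) =
    subst (λ v → GR⁻⊢ θ t ⇒ signed v (tr (rosserAxioms D) t))
      (All.lookup (proj₂ (∈-filter⁻ Coherent? {xs = valuations atoms} t∈)) D∈)
      (tr-closed (rosserAxioms D) t (closedRosser D∈))
  ... | inj₂ (inj₂ G≡) = weaken (by₂ (by₂ (G⇒□ t) (□⇒□G t) ∧-intro) (by₂ (□⇒□⊥∨G t) (□¬⇒□¬G t) ∧-intro)
      λ c d → ∧-intro (∧-elimˡ c) (∧-intro (∧-elimʳ c) (∧-intro (∧-elimˡ d)
        (⇒-intro λ n → ¬-intro λ m → ¬-elim n (⇒-elim (∧-elimʳ d) m)))))
    where open Default (tr D) (tr (■ D)) G≡

  -- Induction on derivations for all types at once, since `nec` uses its premise at the successor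
  -- types.
  tr-sound : ∀ {B t} → GR⁻⊢ B → t ∈ types → GR⁻⊢ θ t ⇒ tr B t
  tr-sound {B} {t} (taut v) _ = tautology (⇒-intro λ _ → ⟨ trans (eval-tr t B) (v _) ⟩)
  tr-sound {t = t} (axK B C) _ = weaken (□ᵗ-K (tr B) (tr C) t)
  tr-sound {t = t} (axL B) _ = weaken (□ᵗ-löb (tr B) t)
  tr-sound (ax■□ D) t∈ = by₁ (tr-rosserAxioms D t∈) λ f → ⇒-intro (∧-elimˡ ∘ ⇒-elim f)
  tr-sound (ax□□■ D) t∈ = by₁ (tr-rosserAxioms D t∈) λ f → ⇒-intro (∧-elimˡ ∘ ∧-elimʳ ∘ ⇒-elim f)
  tr-sound (ax□⊥■ D) t∈ = by₁ (tr-rosserAxioms D t∈) λ f →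
    ⇒-intro (∧-elimˡ ∘ ∧-elimʳ ∘ ∧-elimʳ ∘ ⇒-elim f)
  tr-sound (ax◇■ D) t∈ = by₁ (tr-rosserAxioms D t∈) λ f →
    ⇒-intro (∧-elimʳ ∘ ∧-elimʳ ∘ ∧-elimʳ ∘ ⇒-elim f)
  tr-sound (mp d e) t∈ = by₂ (tr-sound d t∈) (tr-sound e t∈) λ f g →
    ⇒-intro λ a → ⇒-elim (⇒-elim f a) (⇒-elim g a)
  tr-sound {t = t} (nec d) _ = weaken (□ᵗ-nec t (tr-sound d))

  -- The uniform interpolant

  supporting : List Valuation
  supporting = filter (λ t → eval t A ≟ᵇ true) types

  interpolant : Form
  interpolant = ⋁ θ supporting

  ⊢interpolant : GR⁻⊢ A ⇒ interpolant
  ⊢interpolant = by₂ ⊢diagrams (⊢⋀ {f = λ t → diagram t ⇒ θ t} supporting λ {t} _ → diagram⇒θ t) λ c f →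
    ⇒-intro λ a →
      let t , t∈ , d = ⋁-elim types c
          t∈′ = ∈-filter⁺ (λ t → eval t A ≟ᵇ true) t∈
                  (trans (sym (eval-diagram A (proj₁ closure) d)) (holds a))
      in ⋁-intro t∈′ (⇒-elim (⋀-elim f t∈′) d)

  -- At a supporting type `tr-closed` gives the translation of `A`, `tr-sound` passes to that of
  -- `B`, and `tr-PFree` returns to `B`.
  interpolant-least : ∀ B → GR⁻⊢ A ⇒ B → PFree B → GR⁻⊢ interpolant ⇒ B
  interpolant-least B A⇒B pf = by₁ (⊢⋀ {f = λ t → θ t ⇒ B} supporting λ {t} t∈ →
      let t∈types , tA = ∈-filter⁻ (λ t → eval t A ≟ᵇ true) {xs = types} t∈
          trA = subst (λ v → GR⁻⊢ θ t ⇒ signed v (tr A t)) tA (tr-closed A t (proj₁ closure))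
      in by₃ (tr-sound A⇒B t∈types) trA (tr-PFree B t pf) λ f g h → ⇒-intro λ a →
        ⇔-elimˡ (⇒-elim h a) (⇒-elim (⇒-elim f a) (⇒-elim g a)))
    λ c → ⇒-intro λ d →
      let _ , t∈ , a = ⋁-elim supporting d in ⇒-elim (⋀-elim c t∈) a

  -- The variables of the interpolant

  Allowed : Form → Set
  Allowed B = All (λ p → p ∈ V × p ∉ P) (vars B)

  Allowed-⋁ : ∀ {f : X → Form} xs → (∀ {x} → x ∈ xs → Allowed (f x)) → Allowed (⋁ f xs)
  Allowed-⋁ []       g = []
  Allowed-⋁ (x ∷ xs) g = ++⁺ (g (here refl)) (Allowed-⋁ xs (g ∘ there))

  Allowed-⋀ : ∀ {f : X → Form} xs → (∀ {x} → x ∈ xs → Allowed (f x)) → Allowed (⋀ f xs)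
  Allowed-⋀ []       g = []
  Allowed-⋀ (x ∷ xs) g = ++⁺ (g (here refl)) (Allowed-⋀ xs (g ∘ there))

  Allowed-signed : ∀ b {B} → Allowed B → Allowed (signed b B)
  Allowed-signed true  v = v
  Allowed-signed false v = v

  Allowed-literals : ∀ t → Allowed (literals t)
  Allowed-literals t = ++⁺
    (Allowed-⋀ _ λ {p} p∈ → Allowed-signed (t (var p)) {var p}
      (∈-filter⁻ (λ p → ¬? (p ∈ⁿ? P)) {xs = V} p∈ ∷ []))
    (Allowed-⋀ _ λ {D} D∈ → Allowed-signed (t (■ D)) {■ D}
      (let D∈K , pf = ∈-filter⁻ PFree? {xs = K} D∈
       in All.zip (proj₂ (All.lookup (proj₂ (proj₂ closure)) D∈K) , pf)))

  Allowed-forced : ∀ {F} t → (∀ x → Allowed (F x)) → Allowed (forced F t)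
  Allowed-forced t v = Allowed-⋀ (unboxed t) λ {B} _ → Allowed-⋁ (witnesses t B) λ {x} _ → v x

  Allowed-step : ∀ {F} t x → (∀ x → Allowed (F x)) → Allowed (step F t x)
  Allowed-step t x v with t ⊒? x
  ... | yes _ = ++⁺ (Allowed-literals x) (Allowed-forced x v)
  ... | no _  = v x

  Allowed-approx : ∀ n t → Allowed (approx n t)
  Allowed-approx zero    t = []
  Allowed-approx (suc n) t = ++⁺ (Allowed-literals t) (++⁺ (Allowed-forced t (Allowed-approx n))
    (Allowed-⋁ (successors t) λ {x} _ → Allowed-step t x (Allowed-approx n)))

  Allowed-interpolant : Allowed interpolant
  Allowed-interpolant = Allowed-⋁ supporting λ {t} _ → Allowed-approx (suc (length L)) t

theorem6p4 : (A : Form) (P : List ℕ) →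
    Σ Form (λ C →
    ((p : ℕ) → p ∈ vars C → (p ∈ vars A × p ∉ P))
    × (GR⁻⊢ (A ⇒ C))
    × ((B : Form) → GR⁻⊢ (A ⇒ B) → ((p : ℕ) → p ∈ vars B → p ∉ P) → GR⁻⊢ (C ⇒ B)))
theorem6p4 A P = interpolant , (λ _ → All.lookup Allowed-interpolant) , ⊢interpolant ,
    λ B A⇒B free → interpolant-least B A⇒B (All.tabulate (free _))
  where open Interpolant A P
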